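{- Let $r$ and $k$ be positive integers with $r\ge 2$, $r+k\equiv 1\pmod 2$ and $k<r$, and let $G$ be a graph with $\chi(G)\le r$. Let $P\subset V(G)$ and let $d\colon P\to[r+k]$ be a precoloring of $P$ in $G$. If $|\mathcal{D}_G(P,2)|<\min\left\{3(r+k-1),\ \frac18(r+k+3)(r+k+5)\right\}$, then $d$ can be extended to a $\frac{3r+k+1}{2}$-coloring of $G$.
   Context: For a graph $G$ and $P\subset V(G)$, $\mathcal{D}_G(P,2)=\{\{x,y\}\subset P: x\ne y,\ d_G(x,y)\le 2\}$, where $d_G$ is the distance in $G$. $[m]=\{1,\dots,m\}$. A precoloring of $P$ in $G$ is a proper coloring of $G[P]$; an $m$-coloring of $G$ is a proper coloring using at most $m$ colors; $d$ is extended by a coloring $f$ of $G$ if $f(v)=d(v)$ for all $v\in P$. -}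

module Defs where

open import Data.Fin as Fin using (Fin; toℕ)
open import Data.Fin.Properties as Fin using (any?)
open import Data.Fin.Subset using (Subset; _∈_)
open import Data.Fin.Subset.Properties using (_∈?_)
open import Data.List using (List; allFin; cartesianProduct; filter; length)
open import Data.Nat using (ℕ; zero; suc; _≤_; z≤n; s≤s)
open import Data.Nat.Properties using (≤-refl; ≤-pred; m≤n⇒m≤1+n; m≤n⇒m<n∨m≡n; ≮⇒≥)
open import Data.Product using (∃; Σ; _×_; _,_; proj₁; proj₂)
open import Data.Sum using (_⊎_; inj₁; inj₂)
open import Relation.Binary using (Decidable; Irreflexive; Symmetric)
open import Relation.Binary.PropositionalEquality using (_≡_; _≢_; refl)
open import Relation.Nullary using (Dec; yes; no; ¬_)
open import Relation.Nullary.Decidable using (map′; _×-dec_)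

record Graph (V : Set) : Set₁ where
  field
    Adj    : V → V → Set
    adj?   : Decidable Adj
    sym    : Symmetric Adj
    irrefl : Irreflexive _≡_ Adj

open Graph public using (Adj; adj?)

_[_] : ∀ {n} → Graph (Fin n) → (P : Subset n) → Graph (∃ (_∈ P))
G [ P ] = record
  { Adj    = λ u v → Adj G (proj₁ u) (proj₁ v)
  ; adj?   = λ u v → adj? G (proj₁ u) (proj₁ v)
  ; sym    = Graph.sym G
  ; irrefl = λ { refl → Graph.irrefl G refl }
  }

Proper : ∀ {V C : Set} → Graph V → (V → C) → Set
Proper G c = ∀ {u v} → Adj G u v → c u ≢ c v

-- The palette [m] = {1,…,m} is Fin m; a colour i + 1 of [m] is the element
-- of Fin m with toℕ equal to i.
IsColoring : ∀ {V} → Graph V → (m : ℕ) → (V → Fin m) → Set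
IsColoring G m f = Proper G f

Colorable : ∀ {V} → Graph V → ℕ → Set
Colorable {V} G m = Σ (V → Fin m) (IsColoring G m)

IsChromaticNumber : ∀ {V} → Graph V → ℕ → Set
IsChromaticNumber G χ = Colorable G χ × (∀ m → Colorable G m → χ ≤ m)

IsPrecoloring : ∀ {n m} → Graph (Fin n) → (P : Subset n) → (∃ (_∈ P) → Fin m) → Set
IsPrecoloring G P d = Proper (G [ P ]) d

-- d and f may have palettes of different sizes, [m] and [m′], both regarded as
-- initial segments of ℕ; hence the comparison through toℕ.
Extends : ∀ {n m m′} (P : Subset n) → (Fin n → Fin m′) → (∃ (_∈ P) → Fin m) → Set
Extends P f d = ∀ v (v∈P : v ∈ P) → toℕ (f v) ≡ toℕ (d (v , v∈P))

data Walk {V} (G : Graph V) : V → V → ℕ → Set where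
  nil  : ∀ {x} → Walk G x x zero
  cons : ∀ {x y z k} → Adj G x y → Walk G y z k → Walk G x z (suc k)

-- No k satisfies this when x and y lie in different components (distance ∞).
IsDistance : ∀ {V} → Graph V → V → V → ℕ → Set
IsDistance G x y k = Walk G x y k × (∀ j → Walk G x y j → k ≤ j)

Distance≤ : ∀ {V} → Graph V → ℕ → V → V → Set
Distance≤ G t x y = ∃ λ k → IsDistance G x y k × k ≤ t

walk? : ∀ {n} (G : Graph (Fin n)) x y k → Dec (Walk G x y k)
walk? G x y zero    = map′ (λ { refl → nil }) (λ { nil → refl }) (x Fin.≟ y)
walk? G x y (suc k) =
  map′ (λ { (_ , a , w) → cons a w }) (λ { (cons a w) → _ , a , w })
       (any? λ z → adj? G x z ×-dec walk? G z y k)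

distance≤? : ∀ {n} (G : Graph (Fin n)) t x y → Dec (Distance≤ G t x y)
distance≤? G t x y with search t
  where
  search : ∀ t → Distance≤ G t x y ⊎ (∀ j → j ≤ t → ¬ Walk G x y j)
  search zero with walk? G x y zero
  ... | yes w = inj₁ (zero , (w , λ _ _ → z≤n) , z≤n)
  ... | no ¬w = inj₂ λ { zero _ → ¬w }
  search (suc t) with search t
  ... | inj₁ (k , isDist , k≤t) = inj₁ (k , isDist , m≤n⇒m≤1+n k≤t)
  ... | inj₂ none with walk? G x y (suc t)
  ...   | yes w = inj₁ (suc t , (w , λ j wj → ≮⇒≥ λ j<1+t → none j (≤-pred j<1+t) wj) , ≤-refl)
  ...   | no ¬w = inj₂ λ j j≤1+t wj → case (m≤n⇒m<n∨m≡n j≤1+t) wj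
    where
    case : ∀ {j} → suc j ≤ suc t ⊎ j ≡ suc t → ¬ Walk G x y j
    case (inj₁ (s≤s j≤t)) = none _ j≤t
    case (inj₂ refl)      = ¬w
... | inj₁ p    = yes p
... | inj₂ none = no λ { (k , (w , _) , k≤t) → none k k≤t w }

ClosePair : ∀ {n} → Graph (Fin n) → Subset n → ℕ → Fin n × Fin n → Set
ClosePair G P t (x , y) = x Fin.< y × x ∈ P × y ∈ P × Distance≤ G t x y

closePair? : ∀ {n} (G : Graph (Fin n)) P t xy → Dec (ClosePair G P t xy)
closePair? G P t (x , y) = x Fin.<? y ×-dec x ∈? P ×-dec y ∈? P ×-dec distance≤? G t x y

-- A two-element subset {x,y} is represented by its increasing listing (x , y)
-- with x < y, so each one is enumerated exactly once.
𝒟 : ∀ {n} → Graph (Fin n) → Subset n → ℕ → List (Fin n × Fin n)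
𝒟 {n} G P t = filter (closePair? G P t) (cartesianProduct (allFin n) (allFin n))

∣𝒟∣ : ∀ {n} → Graph (Fin n) → Subset n → ℕ → ℕ
∣𝒟∣ G P t = length (𝒟 G P t)

{-# OPTIONS --safe #-}
-- Write r + k = 2t + 1 and give two colours of [r + k] the weight "number of close pairs of P
-- having these colours". A matching of t pairs of colours of total weight at most 1 suffices: fix
-- a proper colouring of G with r classes and attach the t pairs to t distinct classes, and the
-- r − t colours beyond r + k to the other classes. An uncoloured vertex takes the first colour of
-- its pair, or the second if the first occurs at a neighbour in P. This fails only at a common
-- neighbour of a close pair that has the two colours of the pair. If the matching has one pair of
-- weight 1, that pair is attached to the class of an end of its unique close pair, which is
-- harmless because no vertex of that class is adjacent to that end.
--
-- To find the matching, take a matching of weight 0 leaving 2j + 1 colours K uncovered, and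
-- reduce j while possible. When stuck with j ≥ 2, all pairs inside K have positive weight, and
-- for a matched pair {e , f} either e (say) has positive weight to all of K and f has weight 0 to
-- two elements of K, or there are at least 4j units of weight between {e , f} and K. For j ≥ 3
-- this gives total weight at least 6t. For j = 2, any two pairs of the first kind moreover have
-- w(e , e′) ≥ 1, so with p pairs of the first kind and q others the total is at least 10 + 5p +
-- p(p − 1)/2 + 8q. For j = 1, K is a triangle: unless a matching of weight at most 1 appears, it
-- has weight at least 6 and each matched pair contributes at least 6 more.
module Submission where

open import Algebra.Solver.CommutativeMonoid using ()
open import Data.Bool using (if_then_else_)
open import Data.Empty using (⊥; ⊥-elim)
open import Data.Fin as Fin using (Fin; zero; suc; toℕ; join; splitAt; inject≤)
open import Data.Fin.Permutation.Components using (transpose; transpose-inverse)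
open import Data.Fin.Properties as Fin using (any?; inject≤-injective; toℕ-↑ˡ; splitAt-join; join-splitAt)
open import Data.Fin.Subset using (Subset; _∈_)
open import Data.Fin.Subset.Properties using (_∈?_)
open import Data.List using (List; []; _∷_; [_]; _++_; length; map; allFin; lookup)
open import Data.List.Membership.Propositional using () renaming (_∈_ to _∈ₗ_)
open import Data.List.Membership.Propositional.Properties using (∈-filter⁺; ∈-cartesianProduct⁺; ∈-allFin; ∈-lookup)
open import Data.List.Properties using (length-++; length-tabulate; map-++; ++-assoc)
open import Data.List.Relation.Binary.Permutation.Propositional using (_↭_; prep; swap; ↭-refl; ↭-reflexive; ↭-sym; ↭-trans; ↭⇒↭ₛ)
open import Data.List.Relation.Binary.Permutation.Propositional.Properties using (++-commutativeMonoid; ++⁺ˡ; ++⁺ʳ; ↭-length; All-resp-↭; map⁺)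
import Data.List.Relation.Binary.Permutation.Setoid.Properties as Permutation
open import Data.List.Relation.Unary.All as All using (All; []; _∷_)
import Data.List.Relation.Unary.All.Properties as All
open import Data.List.Relation.Unary.AllPairs using (AllPairs; []; _∷_)
open import Data.List.Relation.Unary.Any using (here; there)
open import Data.List.Relation.Unary.Unique.Propositional using (Unique)
open import Data.List.Relation.Unary.Unique.Propositional.Properties using (allFin⁺)
open import Data.Nat using (ℕ; zero; suc; _+_; _*_; _∸_; _≤_; _<_; _⊓_; _≤?_; z≤n; s≤s)
open import Data.Nat.DivMod using (_/_; _%_; m≡m%n+[m/n]*n; m*n/n≡m; m/n*n≤m)
open import Data.Nat.ListAction using (sum)
open import Data.Nat.ListAction.Properties using (sum-++; sum-↭)
open import Data.Nat.Properties
open import Data.Nat.Tactic.RingSolver using (solve-∀)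
open import Data.Product using (∃; ∃₂; Σ; _×_; _,_; proj₁; proj₂)
open import Data.Sum using (_⊎_; inj₁; inj₂; [_,_]′)
open import Data.Sum.Properties using (inj₁-injective; inj₂-injective)
open import Data.Vec.Properties.WithK using ([]=-irrelevant)
open import Function using (_∘_)
open import Relation.Binary using (tri<; tri≈; tri>)
open import Relation.Binary.PropositionalEquality using (_≡_; _≢_; refl; sym; trans; cong; cong₂; subst; setoid)
open import Relation.Nullary using (Dec; yes; no; does; ¬_; contradiction)
open import Relation.Nullary.Decidable using (map′; _×-dec_; dec-true)
open import Defs

-- Matchings as lists of pairs, and searches in lists up to permutation.

module _ {A : Set} where

  module ↭-Solver = Algebra.Solver.CommutativeMonoid (++-commutativeMonoid {A = A})

  -- A matching in `l` with uncovered part `K` is encoded as `flat ps ++ K ↭ l`. When `l` has no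
  -- repetitions, this says both that the pairs are disjoint and which elements they miss.
  flat : List (A × A) → List A
  flat []             = []
  flat ((a , b) ∷ ps) = a ∷ b ∷ flat ps

  flat-↭ : ∀ {ps qs} → ps ↭ qs → flat ps ↭ flat qs
  flat-↭ _↭_.refl                     = ↭-refl
  flat-↭ (prep (a , b) p)             = prep a (prep b (flat-↭ p))
  flat-↭ (swap {ys = ys} (a , b) (c , d) p) =
    ↭-trans (prep a (prep b (prep c (prep d (flat-↭ p)))))
            (solve 5 (λ a b c d f → a ⊕ b ⊕ c ⊕ d ⊕ f ⊜ c ⊕ d ⊕ a ⊕ b ⊕ f) ↭-refl [ a ] [ b ] [ c ] [ d ] (flat ys))
    where open ↭-Solver
  flat-↭ (_↭_.trans p q)              = ↭-trans (flat-↭ p) (flat-↭ q)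

  flat-++ : ∀ ps qs → flat (ps ++ qs) ≡ flat ps ++ flat qs
  flat-++ []             qs = refl
  flat-++ ((a , b) ∷ ps) qs = cong (λ l → a ∷ b ∷ l) (flat-++ ps qs)

  length-flat : ∀ ps → length (flat ps) ≡ 2 * length ps
  length-flat []       = refl
  length-flat (p ∷ ps) = trans (cong (2 +_) (length-flat ps)) (sym (*-suc 2 (length ps)))

  length-flat-++ : ∀ ps K → length (flat ps ++ K) ≡ 2 * length ps + length K
  length-flat-++ ps K = trans (length-++ (flat ps)) (cong (_+ length K) (length-flat ps))

module _ {A : Set} where

  -- The alternative is a positive `Q` rather than the negation of `P`, so that a failed search
  -- yields lower bounds on weights directly.
  find : {P Q : A → Set} → (∀ x → P x ⊎ Q x) → ∀ l → (∃₂ λ x R → l ↭ x ∷ R × P x) ⊎ All Q l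
  find dec []      = inj₂ []
  find dec (x ∷ l) with dec x | find dec l
  ... | inj₁ px | _                      = inj₁ (x , l , ↭-refl , px)
  ... | inj₂ _  | inj₁ (y , R , l↭ , py) = inj₁ (y , x ∷ R , ↭-trans (prep x l↭) (swap x y ↭-refl) , py)
  ... | inj₂ qx | inj₂ ql                = inj₂ (qx ∷ ql)

  findPair : {P Q : A → A → Set} → (∀ x y → P x y ⊎ Q x y) → ∀ l →
             (∃₂ λ x y → ∃ λ R → l ↭ x ∷ y ∷ R × P x y) ⊎ AllPairs Q l
  findPair dec []      = inj₂ []
  findPair dec (x ∷ l) with find (dec x) l | findPair dec l
  ... | inj₁ (y , R , l↭ , pxy) | _                           = inj₁ (x , y , R , prep x l↭ , pxy)
  ... | inj₂ _  | inj₁ (y , z , R , l↭ , pyz) =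
        inj₁ (y , z , x ∷ R , ↭-trans (prep x l↭) (↭-trans (swap x y ↭-refl) (prep y (swap x z ↭-refl))) , pyz)
  ... | inj₂ qx | inj₂ ql                     = inj₂ (qx ∷ ql)

-- Arithmetic of the linear and the quadratic bound.

zero⊎pos : ∀ n → n ≡ 0 ⊎ 1 ≤ n
zero⊎pos zero    = inj₁ refl
zero⊎pos (suc n) = inj₂ (s≤s z≤n)

small⊎large : ∀ n → n ≤ 1 ⊎ 2 ≤ n
small⊎large n with n ≤? 1
... | yes n≤1 = inj₁ n≤1
... | no  n≰1 = inj₂ (≰⇒> n≰1)

+-interchange : ∀ a b c d → (a + b) + (c + d) ≡ (a + c) + (b + d)
+-interchange = solve-∀

-- The binomial coefficient n choose 2.
tri : ℕ → ℕ
tri zero    = 0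
tri (suc n) = n + tri n

2*tri : ∀ n → 2 * tri n + n ≡ n * n
2*tri zero    = refl
2*tri (suc n) = trans (lem n (tri n)) (trans (cong (λ z → z + (n + suc n)) (2*tri n)) (lem′ n))
  where
  lem : ∀ n x → 2 * (n + x) + suc n ≡ (2 * x + n) + (n + suc n)
  lem = solve-∀
  lem′ : ∀ n → n * n + (n + suc n) ≡ suc n * suc n
  lem′ = solve-∀

n≤1+tri : ∀ n → n ≤ 1 + tri n
n≤1+tri zero    = z≤n
n≤1+tri (suc n) = s≤s (m≤m+n n (tri n))

-- The inequality fails at 5, which is why five uncovered colours are treated separately.
3n≤3+tri : ∀ i → 3 * (7 + i) ≤ 3 + tri (7 + i)
3n≤3+tri zero    = m≤m+n 21 3
3n≤3+tri (suc i) = begin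
  3 * (8 + i)                     ≡⟨ lem i ⟩
  3 + 3 * (7 + i)                 ≤⟨ +-mono-≤ (m≤m+n 3 (4 + i)) (3n≤3+tri i) ⟩
  (7 + i) + (3 + tri (7 + i))     ≡⟨ lem′ i (tri (7 + i)) ⟩
  3 + ((7 + i) + tri (7 + i))     ∎
  where
  open ≤-Reasoning
  lem : ∀ i → 3 * (8 + i) ≡ 3 + 3 * (7 + i)
  lem = solve-∀
  lem′ : ∀ i x → (7 + i) + (3 + x) ≡ 3 + ((7 + i) + x)
  lem′ = solve-∀

-- For `q = 0` the quadratic bound is exactly 8 times the assumed lower bound on `N`. Against the
-- rate of 6 per matched pair needed for the linear bound, each of the `q` pairs gains 2 and each of
-- the `p` pairs loses 1, a loss that `tri p` offsets up to 1.
edges-around-5 : ∀ p q N → tri p + p * 5 + (q * 8 + 10) ≤ N → let m = 2 * p + (2 * q + 5) in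
                 3 * m ≤ 3 + N ⊎ (m + 3) * (m + 5) ≤ 8 * N
edges-around-5 p 0 N h = inj₂ (begin
  (2 * p + 5 + 3) * (2 * p + 5 + 5)        ≡⟨ lem p ⟩
  80 + 36 * p + 4 * (p * p)                ≡⟨ cong (λ z → 80 + 36 * p + 4 * z) (sym (2*tri p)) ⟩
  80 + 36 * p + 4 * (2 * tri p + p)        ≡⟨ lem′ p (tri p) ⟩
  8 * (tri p + p * 5 + 10)                 ≤⟨ *-monoʳ-≤ 8 h ⟩
  8 * N                                    ∎)
  where
  open ≤-Reasoning
  lem : ∀ p → (2 * p + 5 + 3) * (2 * p + 5 + 5) ≡ 80 + 36 * p + 4 * (p * p)
  lem = solve-∀
  lem′ : ∀ p x → 80 + 36 * p + 4 * (2 * x + p) ≡ 8 * (x + p * 5 + 10)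
  lem′ = solve-∀
edges-around-5 0 1 N h = inj₁ (+-monoʳ-≤ 3 h)
-- With `q = 1` and `p` equal to 1 or 2, the assumed weight misses the linear bound by one, so these
-- two cases go to the quadratic bound.
edges-around-5 1 1 N h = inj₂ (≤-trans (m≤m+n 168 16) (*-monoʳ-≤ 8 h))
edges-around-5 2 1 N h = inj₂ (≤-trans (m≤m+n 224 8) (*-monoʳ-≤ 8 h))
edges-around-5 (suc (suc (suc p))) 1 N h = inj₁ (begin
  3 * (2 * (3 + p) + 7)                    ≡⟨ lem p ⟩
  3 + ((2 + p) + 1 + (3 + p) * 5 + 18)     ≤⟨ +-monoʳ-≤ 3 (+-monoˡ-≤ 18 (+-monoˡ-≤ ((3 + p) * 5) (+-monoʳ-≤ (2 + p) (s≤s z≤n)))) ⟩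
  3 + (tri (3 + p) + (3 + p) * 5 + 18)     ≤⟨ +-monoʳ-≤ 3 h ⟩
  3 + N                                    ∎)
  where
  open ≤-Reasoning
  lem : ∀ p → 3 * (2 * (3 + p) + 7) ≡ 3 + ((2 + p) + 1 + (3 + p) * 5 + 18)
  lem = solve-∀
edges-around-5 p (suc (suc q)) N h = inj₁ (begin
  3 * (2 * p + (2 * (2 + q) + 5))                       ≡⟨ lem p q ⟩
  p + (p * 5 + q * 6 + 27)                              ≤⟨ +-mono-≤ (n≤1+tri p) (m≤m+n _ (1 + 2 * q)) ⟩
  (1 + tri p) + ((p * 5 + q * 6 + 27) + (1 + 2 * q))    ≡⟨ lem′ p q (tri p) ⟩
  3 + (tri p + p * 5 + ((2 + q) * 8 + 10))              ≤⟨ +-monoʳ-≤ 3 h ⟩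
  3 + N                                                 ∎)
  where
  open ≤-Reasoning
  lem : ∀ p q → 3 * (2 * p + (2 * (2 + q) + 5)) ≡ p + (p * 5 + q * 6 + 27)
  lem = solve-∀
  lem′ : ∀ p q x → (1 + x) + ((p * 5 + q * 6 + 27) + (1 + 2 * q)) ≡ 3 + (x + p * 5 + ((2 + q) * 8 + 10))
  lem′ = solve-∀

-- Searching for a matching of weight at most 1.

module Totals {A : Set} (w : A → A → ℕ) where

  row : A → List A → ℕ
  row x l = sum (map (w x) l)

  total : List A → ℕ
  total []      = 0
  total (x ∷ l) = row x l + total l

module Weighted {A : Set} (w : A → A → ℕ) (w-sym : ∀ x y → w x y ≡ w y x) where

  open Totals w

  cross : List (A × A) → List A → ℕ
  cross []             K = 0
  cross ((e , f) ∷ ps) K = (row e K + row f K) + cross ps K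

  Zero : A × A → Set
  Zero (a , b) = w a b ≡ 0

  row-++ : ∀ x l l′ → row x (l ++ l′) ≡ row x l + row x l′
  row-++ x l l′ = trans (cong sum (map-++ (w x) l l′)) (sum-++ (map (w x) l) _)

  row-↭ : ∀ x {l l′} → l ↭ l′ → row x l ≡ row x l′
  row-↭ x p = sum-↭ (map⁺ (w x) p)

  total-↭ : ∀ {l l′} → l ↭ l′ → total l ≡ total l′
  total-↭ _↭_.refl        = refl
  total-↭ (prep x p)      = cong₂ _+_ (row-↭ x p) (total-↭ p)
  total-↭ (swap {ys = ys} x y p)
    rewrite row-↭ x p | row-↭ y p | total-↭ p | w-sym x y =
    +-interchange (w y x) (row x ys) (row y ys) (total ys)
  total-↭ (_↭_.trans p q) = trans (total-↭ p) (total-↭ q)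

  total-flat-++ : ∀ ps K → total (flat ps ++ K) ≡ total (flat ps) + cross ps K + total K
  total-flat-++ []             K = refl
  total-flat-++ ((e , f) ∷ ps) K
    rewrite row-++ e (flat ps) K | row-++ f (flat ps) K | total-flat-++ ps K =
    lem (w e f) (row e (flat ps)) (row e K) (row f (flat ps)) (row f K) (total (flat ps)) (cross ps K) (total K)
    where
    lem : ∀ a b c d e f g h → (a + (b + c)) + ((d + e) + (f + g + h)) ≡ ((a + b) + (d + f)) + ((c + e) + g) + h
    lem = solve-∀

  row≥length : ∀ {x l} → All (λ y → 1 ≤ w x y) l → length l ≤ row x l
  row≥length []       = z≤n
  row≥length (p ∷ ps) = +-mono-≤ p (row≥length ps)

  total≥tri : ∀ {l} → AllPairs (λ x y → 1 ≤ w x y) l → tri (length l) ≤ total l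
  total≥tri []       = z≤n
  total≥tri (p ∷ ps) = +-mono-≤ (row≥length p) (total≥tri ps)

  cross≥ : ∀ {c ps K} → All (λ z → c ≤ row (proj₁ z) K + row (proj₂ z) K) ps → length ps * c ≤ cross ps K
  cross≥ []       = z≤n
  cross≥ (p ∷ ps) = +-mono-≤ p (cross≥ ps)

  row-flat≥ : ∀ {x ps} → All (λ z → 1 ≤ w x (proj₁ z)) ps → length ps ≤ row x (flat ps)
  row-flat≥ []                        = z≤n
  row-flat≥ {x} {(a , b) ∷ ps} (q ∷ qs) = +-mono-≤ q (≤-trans (row-flat≥ qs) (m≤n+m _ (w x b)))

  total-flat≥ : ∀ {ps} → AllPairs (λ z z′ → 1 ≤ w (proj₁ z) (proj₁ z′)) ps → tri (length ps) ≤ total (flat ps)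
  total-flat≥ []                                = z≤n
  total-flat≥ {(a , b) ∷ ps} (q ∷ qs) =
    +-mono-≤ (≤-trans (row-flat≥ q) (m≤n+m _ (w a b))) (≤-trans (total-flat≥ qs) (m≤n+m _ (row b (flat ps))))

  ZeroMatching : ℕ → List A → Set
  ZeroMatching s l = ∃₂ λ ps K → flat ps ++ K ↭ l × All Zero ps × length K ≡ s

  -- The pair `p` is singled out because it alone may have weight 1; it will receive a specially
  -- chosen colour class.
  NearlyZeroMatching : List A → Set
  NearlyZeroMatching l = ∃₂ λ y p → ∃ λ ps → y ∷ flat (p ∷ ps) ↭ l × w (proj₁ p) (proj₂ p) ≤ 1 × All Zero ps

  -- This lemma and the next two flip augmenting paths of lengths 1, 3 and 5 between two uncovered
  -- elements, in the graph of pairs of weight 0.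
  augment₁ : ∀ {s l ps K x y R} → flat ps ++ K ↭ l → All Zero ps → length K ≡ 2 + s →
             K ↭ x ∷ y ∷ R → w x y ≡ 0 → ZeroMatching s l
  augment₁ {ps = ps} {x = x} {y} {R} l↭ zs len K↭ wxy =
    (x , y) ∷ ps , R ,
    ↭-trans (solve 4 (λ x y f r → x ⊕ y ⊕ f ⊕ r ⊜ f ⊕ x ⊕ y ⊕ r) ↭-refl [ x ] [ y ] (flat ps) R)
            (↭-trans (++⁺ˡ (flat ps) (↭-sym K↭)) l↭) ,
    wxy ∷ zs , suc-injective (suc-injective (trans (sym (↭-length K↭)) len))
    where open ↭-Solver

  augment₂ : ∀ {s l e f ps K x y R} → flat ((e , f) ∷ ps) ++ K ↭ l → All Zero ps → length K ≡ 2 + s →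
             K ↭ x ∷ y ∷ R → w e x ≡ 0 → w f y ≡ 0 → ZeroMatching s l
  augment₂ {e = e} {f} {ps} {x = x} {y} {R} l↭ zs len K↭ wex wfy =
    (e , x) ∷ (f , y) ∷ ps , R ,
    ↭-trans (solve 6 (λ e x f y p r → e ⊕ x ⊕ f ⊕ y ⊕ p ⊕ r ⊜ e ⊕ f ⊕ p ⊕ x ⊕ y ⊕ r) ↭-refl
                     [ e ] [ x ] [ f ] [ y ] (flat ps) R)
            (↭-trans (++⁺ˡ (e ∷ f ∷ flat ps) (↭-sym K↭)) l↭) ,
    wex ∷ wfy ∷ zs , suc-injective (suc-injective (trans (sym (↭-length K↭)) len))
    where open ↭-Solver

  augment₃ : ∀ {s l e f e′ f′ ps K x y R} → flat ((e , f) ∷ (e′ , f′) ∷ ps) ++ K ↭ l → All Zero ps →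
             length K ≡ 2 + s → K ↭ x ∷ y ∷ R → w e e′ ≡ 0 → w f x ≡ 0 → w f′ y ≡ 0 → ZeroMatching s l
  augment₃ {e = e} {f} {e′} {f′} {ps} {x = x} {y} {R} l↭ zs len K↭ wee wfx wfy =
    (e , e′) ∷ (f , x) ∷ (f′ , y) ∷ ps , R ,
    ↭-trans (solve 8 (λ e e′ f x f′ y p r →
                        e ⊕ e′ ⊕ f ⊕ x ⊕ f′ ⊕ y ⊕ p ⊕ r ⊜ e ⊕ f ⊕ e′ ⊕ f′ ⊕ p ⊕ x ⊕ y ⊕ r) ↭-refl
                     [ e ] [ e′ ] [ f ] [ x ] [ f′ ] [ y ] (flat ps) R)
            (↭-trans (++⁺ˡ (e ∷ f ∷ e′ ∷ f′ ∷ flat ps) (↭-sym K↭)) l↭) ,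
    wee ∷ wfx ∷ wfy ∷ zs , suc-injective (suc-injective (trans (sym (↭-length K↭)) len))
    where open ↭-Solver

  findZero : ∀ x l → (∃₂ λ y R → l ↭ y ∷ R × w x y ≡ 0) ⊎ All (λ y → 1 ≤ w x y) l
  findZero x = find λ y → zero⊎pos (w x y)

  -- Two zero partners of `f` leave a choice when `f` and the second end of another such pair need
  -- different partners in `K`.
  Lopsided : List A → A × A → Set
  Lopsided K (e , f) = All (λ y → 1 ≤ w e y) K × ∃₂ λ x y → ∃ λ R → K ↭ x ∷ y ∷ R × w f x ≡ 0 × w f y ≡ 0

  -- If one of `e`, `f` has two zero partners in `K`, any zero partner of the other allows disjoint
  -- choices; without one, the pair is lopsided. If each has at most one zero partner, each row has
  -- at least `s` positive entries.
  classify : ∀ e f s K → length K ≡ suc s →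
             (∃₂ λ x y → ∃ λ R → K ↭ x ∷ y ∷ R × w e x ≡ 0 × w f y ≡ 0) ⊎
             (Lopsided K (e , f) ⊎ Lopsided K (f , e)) ⊎
             s + s ≤ row e K + row f K
  classify e f s K len with findZero e K
  classify e f s K len | inj₂ epos with findZero f K
  ... | inj₂ fpos = inj₂ (inj₂ (+-mono-≤ (long e epos) (long f fpos)))
    where
    long : ∀ x → All (λ y → 1 ≤ w x y) K → s ≤ row x K
    long x pos = ≤-trans (n≤1+n s) (subst (_≤ row x K) len (row≥length pos))
  ... | inj₁ (x , R , K↭ , wfx) with findZero f R
  ...   | inj₁ (y , R′ , R↭ , wfy) = inj₂ (inj₁ (inj₁ (epos , x , y , R′ , ↭-trans K↭ (prep x R↭) , wfx , wfy)))
  ...   | inj₂ fpos = inj₂ (inj₂ (+-mono-≤ (≤-trans (n≤1+n s) (subst (_≤ row e K) len (row≥length epos)))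
            (≤-trans (subst (_≤ row f R) (suc-injective (trans (sym (↭-length K↭)) len)) (row≥length fpos))
                     (≤-trans (m≤n+m (row f R) (w f x)) (≤-reflexive (sym (row-↭ f K↭)))))))
  classify e f s K len | inj₁ (x , R , K↭ , wex) with findZero f R
  ... | inj₁ (y , R′ , R↭ , wfy) = inj₁ (x , y , R′ , ↭-trans K↭ (prep x R↭) , wex , wfy)
  ... | inj₂ fpos with findZero e R
  ...   | inj₂ epos = inj₂ (inj₂ (+-mono-≤ (bound e epos) (bound f fpos)))
    where
    bound : ∀ z → All (λ y → 1 ≤ w z y) R → s ≤ row z K
    bound z pos = ≤-trans (subst (_≤ row z R) (suc-injective (trans (sym (↭-length K↭)) len)) (row≥length pos))
                          (≤-trans (m≤n+m (row z R) (w z x)) (≤-reflexive (sym (row-↭ z K↭))))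
  ...   | inj₁ (y , R′ , R↭ , wey) with zero⊎pos (w f x)
  ...     | inj₁ wfx = inj₁ (y , x , R′ , ↭-trans K↭ (↭-trans (prep x R↭) (swap x y ↭-refl)) , wey , wfx)
  ...     | inj₂ wfx = inj₂ (inj₁ (inj₂ (All-resp-↭ (↭-sym K↭) (wfx ∷ fpos) ,
                                         x , y , R′ , ↭-trans K↭ (prep x R↭) , wex , wey)))

  -- With `m = length l`, the total reaches `3 (m - 1)` or `(m + 3) (m + 5) / 8`; subtraction and
  -- division are cleared.
  ManyEdges : List A → Set
  ManyEdges l = 3 * length l ≤ 3 + total l ⊎ (length l + 3) * (length l + 5) ≤ 8 * total l

  lopsided-length≤ : ∀ {K e f} → Lopsided K (e , f) → length K ≤ row e K + row f K
  lopsided-length≤ {K} {e} {f} (pos , _) = ≤-trans (row≥length pos) (m≤m+n (row e K) (row f K))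

  -- `Z` keeps the pairs already passed, so that an augmentation found at any pair acts on the whole
  -- matching. `I` collects the lopsided pairs and `O` the heavy ones.
  classify-all : ∀ {l s K} → length K ≡ 2 + s → ∀ ps Z → flat ps ++ flat Z ++ K ↭ l → All Zero ps → All Zero Z →
    ZeroMatching s l ⊎
    ∃₂ λ I O → flat I ++ flat O ↭ flat ps × All Zero I × All Zero O ×
               All (Lopsided K) I × All (λ z → suc s + suc s ≤ row (proj₁ z) K + row (proj₂ z) K) O
  classify-all len [] Z l↭ zs zZ = inj₂ ([] , [] , ↭-refl , [] , [] , [] , [])
  classify-all {K = K} len ((e , f) ∷ ps) Z l↭ (z ∷ zs) zZ
    with classify-all len ps ((e , f) ∷ Z)
           (↭-trans (solve 5 (λ e f p q k → p ⊕ (e ⊕ f ⊕ q) ⊕ k ⊜ (e ⊕ f ⊕ p) ⊕ q ⊕ k) ↭-refl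
                             [ e ] [ f ] (flat ps) (flat Z) K) l↭) zs (z ∷ zZ)
       | classify e f _ K len
    where open ↭-Solver
  ... | inj₁ m | _ = inj₁ m
  ... | inj₂ _ | inj₁ (x , y , R , K↭ , wex , wfy) =
    inj₁ (augment₂ {ps = ps ++ Z} (↭-trans (prep e (prep f (↭-reflexive eq))) l↭) (All.++⁺ zs zZ) len K↭ wex wfy)
    where
    eq : flat (ps ++ Z) ++ K ≡ flat ps ++ flat Z ++ K
    eq = trans (cong (_++ K) (flat-++ ps Z)) (++-assoc (flat ps) (flat Z) K)
  ... | inj₂ (I , O , IO↭ , zI , zO , lI , lO) | inj₂ (inj₁ (inj₁ L)) =
    inj₂ ((e , f) ∷ I , O , prep e (prep f IO↭) , z ∷ zI , zO , L ∷ lI , lO)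
  -- The pair is turned round so that the end positive on all of `K` comes first.
  ... | inj₂ (I , O , IO↭ , zI , zO , lI , lO) | inj₂ (inj₁ (inj₂ L)) =
    inj₂ ((f , e) ∷ I , O , swap f e IO↭ , trans (w-sym f e) z ∷ zI , zO , L ∷ lI , lO)
  ... | inj₂ (I , O , IO↭ , zI , zO , lI , lO) | inj₂ (inj₂ b) =
    inj₂ (I , (e , f) ∷ O ,
          ↭-trans (solve 4 (λ e f i o → i ⊕ e ⊕ f ⊕ o ⊜ e ⊕ f ⊕ i ⊕ o) ↭-refl [ e ] [ f ] (flat I) (flat O)) (prep e (prep f IO↭)) ,
          zI , z ∷ zO , lI , b ∷ lO)
    where open ↭-Solver

  -- The path runs through `f`, `e`, `e′`, `f′`. If `f′` has a zero partner other than `x`, then `f`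
  -- takes `x`; otherwise `f` takes `y` and leaves `x` to `f′`.
  lopsided-augment : ∀ {s l K e f e′ f′ ps} → flat ((e , f) ∷ (e′ , f′) ∷ ps) ++ K ↭ l → All Zero ps → length K ≡ 2 + s →
                     Lopsided K (e , f) → Lopsided K (e′ , f′) → w e e′ ≡ 0 → ZeroMatching s l
  lopsided-augment {f′ = f′} l↭ zs len (_ , x , y , R , K↭ , wfx , wfy) (_ , x′ , _ , _ , K↭′ , wfx′ , _) wee
    with findZero f′ (y ∷ R)
  ... | inj₁ (v , R′ , R↭ , wfv) = augment₃ l↭ zs len (↭-trans K↭ (prep x R↭)) wee wfx wfv
  ... | inj₂ (_ ∷ pos) with zero⊎pos (w f′ x)
  ...   | inj₁ wfx″ = augment₃ l↭ zs len (↭-trans K↭ (swap x y ↭-refl)) wee wfy wfx″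
  -- Here `f′` would have positive weight to every element of `K`, contrary to `wfx′`.
  lopsided-augment {f′ = f′} l↭ zs len (_ , x , y , R , K↭ , wfx , wfy) (_ , x′ , _ , _ , K↭′ , wfx′ , _) wee
    | inj₂ (ypos ∷ pos) | inj₂ xpos with All-resp-↭ (↭-trans (↭-sym K↭) K↭′) (xpos ∷ ypos ∷ pos)
  ... | x′pos ∷ _ with subst (1 ≤_) wfx′ x′pos
  ... | ()

  -- A matched pair adds 2 to the length, hence 6 to the left side of the linear bound, and its
  -- weight towards `K` pays for this.
  manyEdges : ∀ {l ps K} → flat ps ++ K ↭ l →
    All (λ z → 6 ≤ row (proj₁ z) K + row (proj₂ z) K) ps → 3 * length K ≤ 3 + total K → ManyEdges l
  manyEdges {l} {ps} {K} l↭ six K≤ 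
    rewrite sym (↭-length l↭) | sym (total-↭ l↭) | length-flat-++ ps K | total-flat-++ ps K =
    inj₁ (lin (length ps) (length K) _ (total K) (≤-trans (cross≥ six) (m≤n+m _ (total (flat ps)))) K≤)
    where
    lin : ∀ p s x y → p * 6 ≤ x → 3 * s ≤ 3 + y → 3 * (2 * p + s) ≤ 3 + (x + y)
    lin p s x y h h′ = begin
      3 * (2 * p + s)  ≡⟨ lem p s ⟩
      p * 6 + 3 * s    ≤⟨ +-mono-≤ h h′ ⟩
      x + (3 + y)      ≡⟨ lem′ x y ⟩
      3 + (x + y)      ∎
      where
      open ≤-Reasoning
      lem : ∀ p s → 3 * (2 * p + s) ≡ p * 6 + 3 * s
      lem = solve-∀
      lem′ : ∀ x y → x + (3 + y) ≡ 3 + (x + y)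
      lem′ = solve-∀

  -- Stuck pairs of either kind send at least 6 to `K`: a lopsided one at least `length K`, a heavy
  -- one at least twice `length K - 1`.
  reduce≥7 : ∀ i {l} → ZeroMatching (7 + i) l → ZeroMatching (5 + i) l ⊎ ManyEdges l
  reduce≥7 i (ps , K , l↭ , zs , len) with findPair (λ x y → zero⊎pos (w x y)) K
  ... | inj₁ (x , y , R , K↭ , wxy) = inj₁ (augment₁ l↭ zs len K↭ wxy)
  ... | inj₂ Kpos with classify-all len ps [] l↭ zs []
  ...   | inj₁ m = inj₁ m
  ...   | inj₂ (I , O , IO↭ , _ , _ , lI , lO) =
    inj₂ (manyEdges {ps = I ++ O} (↭-trans (++⁺ʳ K (↭-trans (↭-reflexive (flat-++ I O)) IO↭)) l↭) (All.++⁺ (All.map sixI lI) (All.map sixO lO))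
                    (≤-trans (subst (λ s → 3 * s ≤ 3 + tri s) (sym len) (3n≤3+tri i)) (+-monoʳ-≤ 3 (total≥tri Kpos))))
    where
    sixI : ∀ {z} → Lopsided K z → 6 ≤ row (proj₁ z) K + row (proj₂ z) K
    sixI L = ≤-trans (subst (6 ≤_) (sym len) (m≤m+n 6 (1 + i))) (lopsided-length≤ L)
    sixO : ∀ {z : A × A} → (6 + i) + (6 + i) ≤ row (proj₁ z) K + row (proj₂ z) K → 6 ≤ row (proj₁ z) K + row (proj₂ z) K
    sixO h = ≤-trans (≤-trans (m≤m+n 6 i) (m≤m+n (6 + i) (6 + i))) h

  -- A lopsided pair now guarantees only 5 units. The weights between first ends of lopsided pairs,
  -- positive unless `lopsided-augment` applies, make up for it.
  reduce5 : ∀ {l} → ZeroMatching 5 l → ZeroMatching 3 l ⊎ ManyEdges l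
  reduce5 {l} (ps , K , l↭ , zs , len) with findPair (λ x y → zero⊎pos (w x y)) K
  ... | inj₁ (x , y , R , K↭ , wxy) = inj₁ (augment₁ l↭ zs len K↭ wxy)
  ... | inj₂ Kpos with classify-all len ps [] l↭ zs []
  ...   | inj₁ m = inj₁ m
  ...   | inj₂ (I , O , IO↭ , zI , zO , lI , lO) with findPair (λ z z′ → zero⊎pos (w (proj₁ z) (proj₁ z′))) I
  ...     | inj₁ (z , z′ , J , I↭ , wzz) with All-resp-↭ I↭ zI | All-resp-↭ I↭ lI
  ...       | _ ∷ _ ∷ zJ | L ∷ L′ ∷ _ =
    inj₁ (lopsided-augment {ps = J ++ O} (↭-trans (++⁺ʳ K perm) l↭) (All.++⁺ zJ zO) len L L′ wzz)
    where
    perm : flat (z ∷ z′ ∷ (J ++ O)) ↭ flat ps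
    perm = ↭-trans (↭-reflexive (flat-++ (z ∷ z′ ∷ J) O)) (↭-trans (++⁺ʳ (flat O) (↭-sym (flat-↭ I↭))) IO↭)
  reduce5 {l} (ps , K , l↭ , zs , len) | inj₂ Kpos | inj₂ (I , O , IO↭ , zI , zO , lI , lO) | inj₂ Ipos =
    inj₂ (subst (λ m → 3 * m ≤ 3 + total l ⊎ (m + 3) * (m + 5) ≤ 8 * total l) (sym length-l)
                (edges-around-5 (length I) (length O) (total l) bound))
    where
    l↭′ : flat I ++ (flat O ++ K) ↭ l
    l↭′ = ↭-trans (↭-reflexive (sym (++-assoc (flat I) (flat O) K))) (↭-trans (++⁺ʳ K IO↭) l↭)

    length-l : length l ≡ 2 * length I + (2 * length O + 5)
    length-l = trans (sym (↭-length l↭′)) (trans (length-flat-++ I _)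
                 (cong (2 * length I +_) (trans (length-flat-++ O K) (cong (2 * length O +_) len))))

    five : ∀ {z} → Lopsided K z → 5 ≤ row (proj₁ z) (flat O ++ K) + row (proj₂ z) (flat O ++ K)
    five {e , f} L = ≤-trans (subst (_≤ row e K + row f K) len (lopsided-length≤ L)) (+-mono-≤ (grow e) (grow f))
      where
      grow : ∀ x → row x K ≤ row x (flat O ++ K)
      grow x = subst (row x K ≤_) (sym (row-++ x (flat O) K)) (m≤n+m _ _)

    -- The summands come from inside `I`, from `I` to `K`, from `O` to `K`, and from the ten pairs
    -- inside `K`.
    bound : tri (length I) + length I * 5 + (length O * 8 + 10) ≤ total l
    bound = begin
      tri (length I) + length I * 5 + (length O * 8 + 10)
        ≤⟨ +-mono-≤ (+-mono-≤ (total-flat≥ Ipos) (cross≥ (All.map five lI)))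
                    (+-mono-≤ (≤-trans (cross≥ lO) (m≤n+m _ (total (flat O))))
                              (subst (λ s → tri s ≤ total K) len (total≥tri Kpos))) ⟩
      total (flat I) + cross I (flat O ++ K) + (total (flat O) + cross O K + total K)
        ≡⟨ cong (total (flat I) + cross I (flat O ++ K) +_) (total-flat-++ O K) ⟨
      total (flat I) + cross I (flat O ++ K) + total (flat O ++ K)
        ≡⟨ total-flat-++ I (flat O ++ K) ⟨
      total (flat I ++ (flat O ++ K))
        ≡⟨ total-↭ l↭′ ⟩
      total l ∎
      where open ≤-Reasoning

  nearlyZero₁ : ∀ {l ps x y u} → flat ps ++ (x ∷ y ∷ u ∷ []) ↭ l → All Zero ps → w x y ≤ 1 → NearlyZeroMatching l
  nearlyZero₁ {ps = ps} {x} {y} {u} l↭ zs wxy =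
    u , (x , y) , ps ,
    ↭-trans (solve 4 (λ x y u p → u ⊕ x ⊕ y ⊕ p ⊜ p ⊕ x ⊕ y ⊕ u) ↭-refl [ x ] [ y ] [ u ] (flat ps)) l↭ , wxy , zs
    where open ↭-Solver

  -- One of the two new pairs has weight 0, and the other becomes the distinguished pair.
  nearlyZero₂ : ∀ {l ps e f x y u} → flat ((e , f) ∷ ps) ++ (x ∷ y ∷ u ∷ []) ↭ l → All Zero ps →
                w e x + w f y ≤ 1 → NearlyZeroMatching l
  nearlyZero₂ {ps = ps} {e} {f} {x} {y} {u} l↭ zs h with zero⊎pos (w e x)
  ... | inj₁ wex =
    u , (f , y) , (e , x) ∷ ps ,
    ↭-trans (solve 6 (λ e f x y u p → u ⊕ f ⊕ y ⊕ e ⊕ x ⊕ p ⊜ e ⊕ f ⊕ p ⊕ x ⊕ y ⊕ u) ↭-refl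
                     [ e ] [ f ] [ x ] [ y ] [ u ] (flat ps)) l↭ ,
    ≤-trans (m≤n+m (w f y) (w e x)) h , wex ∷ zs
    where open ↭-Solver
  ... | inj₂ wex =
    u , (e , x) , (f , y) ∷ ps ,
    ↭-trans (solve 6 (λ e f x y u p → u ⊕ e ⊕ x ⊕ f ⊕ y ⊕ p ⊜ e ⊕ f ⊕ p ⊕ x ⊕ y ⊕ u) ↭-refl
                     [ e ] [ f ] [ x ] [ y ] [ u ] (flat ps)) l↭ ,
    ≤-trans (m≤m+n (w e x) (w f y)) h , n≤0⇒n≡0 (+-cancelˡ-≤ 1 _ _ (≤-trans (+-monoˡ-≤ (w f y) wex) h)) ∷ zs
    where open ↭-Solver

  -- For a matched pair, the three cyclic ways of joining `e` and `f` to consecutive corners of the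
  -- triangle use each of the six weights towards it once. If each way costs at least 2, the pair
  -- sends at least 6 to the triangle.
  finish : ∀ {l} → ZeroMatching 3 l → NearlyZeroMatching l ⊎ ManyEdges l
  finish {l} (ps , a ∷ b ∷ c ∷ [] , l↭ , zs , refl)
    with small⊎large (w a b) | small⊎large (w b c) | small⊎large (w c a)
  ... | inj₁ wab | _ | _ = inj₁ (nearlyZero₁ l↭ zs wab)
  ... | inj₂ _ | inj₁ wbc | _ = inj₁ (nearlyZero₁ (↭-trans (++⁺ˡ (flat ps) rotate) l↭) zs wbc)
    where
    rotate : b ∷ c ∷ a ∷ [] ↭ a ∷ b ∷ c ∷ []
    rotate = ↭-trans (prep b (swap c a ↭-refl)) (swap b a ↭-refl)
  ... | inj₂ _ | inj₂ _ | inj₁ wca = inj₁ (nearlyZero₁ (↭-trans (++⁺ˡ (flat ps) rotate) l↭) zs wca)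
    where
    rotate : c ∷ a ∷ b ∷ [] ↭ a ∷ b ∷ c ∷ []
    rotate = ↭-trans (swap c a ↭-refl) (prep a (swap c b ↭-refl))
  ... | inj₂ wab | inj₂ wbc | inj₂ wca with find decide ps
    where
    K = a ∷ b ∷ c ∷ []

    Cheap : A × A → Set
    Cheap (e , f) = ∃₂ λ x y → ∃ λ u → x ∷ y ∷ u ∷ [] ↭ K × w e x + w f y ≤ 1

    decide : ∀ z → Cheap z ⊎ 6 ≤ row (proj₁ z) K + row (proj₂ z) K
    decide (e , f) with small⊎large (w e a + w f b) | small⊎large (w e b + w f c) | small⊎large (w e c + w f a)
    ... | inj₁ h | _ | _ = inj₁ (a , b , c , ↭-refl , h)
    ... | inj₂ _ | inj₁ h | _ = inj₁ (b , c , a , ↭-trans (prep b (swap c a ↭-refl)) (swap b a ↭-refl) , h)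
    ... | inj₂ _ | inj₂ _ | inj₁ h = inj₁ (c , a , b , ↭-trans (swap c a ↭-refl) (prep a (swap c b ↭-refl)) , h)
    ... | inj₂ h | inj₂ h′ | inj₂ h″ =
      inj₂ (≤-trans (+-mono-≤ h (+-mono-≤ h′ h″))
                    (≤-reflexive (lem (w e a) (w e b) (w e c) (w f a) (w f b) (w f c))))
      where
      lem : ∀ a b c d e f → (a + e) + ((b + f) + (c + d)) ≡ (a + (b + (c + 0))) + (d + (e + (f + 0)))
      lem = solve-∀
  ...   | inj₁ ((e , f) , qs , ps↭ , x , y , u , K↭ , h) with All-resp-↭ ps↭ zs
  ...     | _ ∷ zqs =
    inj₁ (nearlyZero₂ (↭-trans (↭-trans (++⁺ˡ (e ∷ f ∷ flat qs) K↭) (++⁺ʳ _ (↭-sym (flat-↭ ps↭)))) l↭) zqs h)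
  finish {l} (ps , a ∷ b ∷ c ∷ [] , l↭ , zs , refl) | inj₂ wab | inj₂ wbc | inj₂ wca | inj₂ six =
    inj₂ (manyEdges l↭ six (+-monoʳ-≤ 3 (≤-trans (+-mono-≤ wab (+-mono-≤ wbc (subst (2 ≤_) (w-sym c a) wca)))
                                                 (≤-reflexive (lem (w a b) (w b c) (w a c))))))
    where
    lem : ∀ x y z → x + (y + z) ≡ (x + (z + 0)) + ((y + 0) + 0)
    lem = solve-∀

  nearlyZeroMatching-from : ∀ i {l} → ZeroMatching (3 + i * 2) l → NearlyZeroMatching l ⊎ ManyEdges l
  nearlyZeroMatching-from zero          m = finish m
  nearlyZeroMatching-from (suc zero)    m = [ finish , inj₂ ]′ (reduce5 m)
  nearlyZeroMatching-from (suc (suc i)) m = [ nearlyZeroMatching-from (suc i) , inj₂ ]′ (reduce≥7 (i * 2) m)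

  nearlyZeroMatching : ∀ i l → length l ≡ 3 + i * 2 → NearlyZeroMatching l ⊎ ManyEdges l
  nearlyZeroMatching i l len = nearlyZeroMatching-from i ([] , l , ↭-refl , [] , len)

-- Weights of colour pairs obtained by counting edges.

module _ {m : ℕ} where

  δ : Fin m → Fin m → ℕ
  δ p x = if does (p Fin.≟ x) then 1 else 0

  δ-refl : ∀ p → δ p p ≡ 1
  δ-refl p rewrite dec-true (p Fin.≟ p) refl = refl

  occurrences : Fin m → List (Fin m) → ℕ
  occurrences p l = sum (map (δ p) l)

  occurrences≡0 : ∀ {p l} → All (p ≢_) l → occurrences p l ≡ 0
  occurrences≡0 []                       = refl
  occurrences≡0 {p} {x ∷ l} (p≢x ∷ p≢l) with p Fin.≟ x
  ... | yes p≡x = ⊥-elim (p≢x p≡x)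
  ... | no  _   = occurrences≡0 p≢l

  occurrences≤1 : ∀ p {l} → Unique l → occurrences p l ≤ 1
  occurrences≤1 p []              = z≤n
  occurrences≤1 p {x ∷ l} (x≢l ∷ u) with p Fin.≟ x
  ... | yes refl rewrite occurrences≡0 x≢l = ≤-refl
  ... | no  _    = occurrences≤1 p u

  -- For `x ≢ y` this is the indicator of `{p, q} = {x, y}`.
  joins : Fin m → Fin m → Fin m → Fin m → ℕ
  joins p q x y = δ p x * δ q y + δ p y * δ q x

  row-joins : ∀ p q x l → Totals.row (joins p q) x l ≡ δ p x * occurrences q l + occurrences p l * δ q x
  row-joins p q x []      = sym (trans (+-identityʳ _) (*-zeroʳ (δ p x)))
  row-joins p q x (y ∷ l) rewrite row-joins p q x l =
    lem (δ p x) (δ q x) (δ p y) (δ q y) (occurrences p l) (occurrences q l)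
    where
    lem : ∀ a b c d e f → (a * d + c * b) + (a * f + e * b) ≡ a * (d + f) + (c + e) * b
    lem = solve-∀

  -- The product counts all ordered pairs of positions holding `p` and `q`; the total leaves out
  -- those where both positions coincide.
  total-joins : ∀ p q l → Totals.total (joins p q) l ≤ occurrences p l * occurrences q l
  total-joins p q []      = z≤n
  total-joins p q (x ∷ l) rewrite row-joins p q x l = begin
    (δ p x * Q + P * δ q x) + Totals.total (joins p q) l   ≤⟨ +-monoʳ-≤ (δ p x * Q + P * δ q x) (total-joins p q l) ⟩
    (δ p x * Q + P * δ q x) + P * Q                        ≤⟨ m≤n+m _ (δ p x * δ q x) ⟩
    δ p x * δ q x + ((δ p x * Q + P * δ q x) + P * Q)      ≡⟨ lem (δ p x) (δ q x) P Q ⟩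
    (δ p x + P) * (δ q x + Q)                              ∎
    where
    open ≤-Reasoning
    P = occurrences p l
    Q = occurrences q l
    lem : ∀ a b c d → a * b + ((a * d + c * b) + c * d) ≡ (a + c) * (b + d)
    lem = solve-∀

module _ {A : Set} where

  open Totals

  row-+ : ∀ (u v : A → A → ℕ) x l → row (λ a b → u a b + v a b) x l ≡ row u x l + row v x l
  row-+ u v x []      = refl
  row-+ u v x (y ∷ l) rewrite row-+ u v x l =
    +-interchange (u x y) (v x y) (row u x l) (row v x l)

  total-+ : ∀ (u v : A → A → ℕ) l → total (λ a b → u a b + v a b) l ≡ total u l + total v l
  total-+ u v []      = refl
  total-+ u v (x ∷ l) rewrite row-+ u v x l | total-+ u v l =
    +-interchange (row u x l) (row v x l) (total u l) (total v l)

  total-0 : ∀ (l : List A) → total (λ _ _ → 0) l ≡ 0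
  total-0 []      = refl
  total-0 (x ∷ l) = cong₂ _+_ (row-0 l) (total-0 l)
    where
    row-0 : ∀ l → row (λ _ _ → 0) x l ≡ 0
    row-0 []      = refl
    row-0 (_ ∷ l) = row-0 l

module EdgeWeight {V : Set} {m : ℕ} (g : V → Fin m) where

  Joins : Fin m → Fin m → V × V → Set
  Joins a b (x , y) = (g x ≡ a × g y ≡ b) ⊎ (g x ≡ b × g y ≡ a)

  weight : List (V × V) → Fin m → Fin m → ℕ
  weight []            a b = 0
  weight ((x , y) ∷ E) a b = joins (g x) (g y) a b + weight E a b

  weight-sym : ∀ E a b → weight E a b ≡ weight E b a
  weight-sym []            a b = refl
  weight-sym ((x , y) ∷ E) a b = cong₂ _+_ (+-comm (δ (g x) a * δ (g y) b) _) (weight-sym E a b)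

  -- An edge contributes at most 1, as each of its end colours occurs at most once in `l`. This
  -- carries the bound on close pairs over to weights.
  total-weight : ∀ E {l} → Unique l → Totals.total (weight E) l ≤ length E
  total-weight []            {l} u = ≤-reflexive (total-0 l)
  total-weight ((x , y) ∷ E) {l} u = begin
    Totals.total (weight ((x , y) ∷ E)) l                                     ≡⟨ total-+ (joins (g x) (g y)) (weight E) l ⟩
    Totals.total (joins (g x) (g y)) l + Totals.total (weight E) l            ≤⟨ +-mono-≤ (total-joins (g x) (g y) l) (total-weight E u) ⟩
    occurrences (g x) l * occurrences (g y) l + length E                      ≤⟨ +-monoˡ-≤ (length E) (*-mono-≤ (occurrences≤1 (g x) u) (occurrences≤1 (g y) u)) ⟩
    suc (length E)                                                            ∎
    where open ≤-Reasoning

  joins-pos : ∀ {a b x y} → Joins a b (x , y) → 1 ≤ joins (g x) (g y) a b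
  joins-pos {a} {b} (inj₁ (refl , refl)) rewrite δ-refl a | δ-refl b = s≤s z≤n
  joins-pos {a} {b} (inj₂ (refl , refl)) rewrite δ-refl a | δ-refl b = m≤n+m 1 (δ b a * δ a b)

  weight-pos : ∀ {E a b e} → e ∈ₗ E → Joins a b e → 1 ≤ weight E a b
  weight-pos {(x , y) ∷ E} {a} {b} (here refl) j = ≤-trans (joins-pos j) (m≤m+n _ (weight E a b))
  weight-pos {(x , y) ∷ E} {a} {b} (there e∈E) j = ≤-trans (weight-pos e∈E j) (m≤n+m _ (joins (g x) (g y) a b))

  -- Weight at most 1 leaves at most one position of `E` whose entry joins `a` and `b`.
  common-value : ∀ {X : Set} (h : V × V → X) → X → ∀ E {a b} → weight E a b ≤ 1 →
                 ∃ λ α → ∀ {e} → e ∈ₗ E → Joins a b e → h e ≡ α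
  common-value h x₀ []            _ = x₀ , λ ()
  common-value h x₀ ((x , y) ∷ E) {a} {b} w≤1 with zero⊎pos (weight E a b)
  -- No entry of the tail joins `a` and `b`, so the value at the head works whether or not the head
  -- does.
  ... | inj₁ w≡0 = h (x , y) , λ where
    (here refl) _ → refl
    (there e∈E) j → contradiction (subst (1 ≤_) w≡0 (weight-pos e∈E j)) λ ()
  ... | inj₂ w≥1 with common-value h x₀ E (≤-trans (m≤n+m _ (joins (g x) (g y) a b)) w≤1)
  ...   | α , same = α , λ where
    (here refl) j → contradiction (≤-trans (+-mono-≤ (joins-pos j) w≥1) w≤1) λ { (s≤s ()) }
    (there e∈E) j → same e∈E j

-- Disjointness of the pairs of a matching.

module _ {A : Set} where

  Disjoint : A × A → A × A → Set
  Disjoint (a , b) (c , d) = a ≢ c × a ≢ d × b ≢ c × b ≢ d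

  All-flat⁻ : ∀ {Q : A → Set} (ps : List (A × A)) → All Q (flat ps) → ∀ i → Q (proj₁ (lookup ps i)) × Q (proj₂ (lookup ps i))
  All-flat⁻ (p ∷ ps) (qa ∷ qb ∷ _)  zero    = qa , qb
  All-flat⁻ (p ∷ ps) (_  ∷ _  ∷ qs) (suc i) = All-flat⁻ ps qs i

  flat-unique⇒≢ : ∀ (ps : List (A × A)) → Unique (flat ps) → ∀ i → proj₁ (lookup ps i) ≢ proj₂ (lookup ps i)
  flat-unique⇒≢ (p ∷ ps) ((a≢b ∷ _) ∷ _) zero    = a≢b
  flat-unique⇒≢ (p ∷ ps) (_ ∷ _ ∷ u)     (suc i) = flat-unique⇒≢ ps u i

  flat-unique⇒Disjoint : ∀ (ps : List (A × A)) → Unique (flat ps) → ∀ {i j} → i ≢ j → Disjoint (lookup ps i) (lookup ps j)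
  flat-unique⇒Disjoint (p ∷ ps) _ {zero} {zero} i≢j = ⊥-elim (i≢j refl)
  flat-unique⇒Disjoint (p ∷ ps) ((_ ∷ a≢) ∷ b≢ ∷ _) {zero} {suc j} _ with All-flat⁻ ps a≢ j | All-flat⁻ ps b≢ j
  ... | a≢c , a≢d | b≢c , b≢d = a≢c , a≢d , b≢c , b≢d
  flat-unique⇒Disjoint (p ∷ ps) ((_ ∷ a≢) ∷ b≢ ∷ _) {suc i} {zero} _ with All-flat⁻ ps a≢ i | All-flat⁻ ps b≢ i
  ... | a≢c , a≢d | b≢c , b≢d = a≢c ∘ sym , b≢c ∘ sym , a≢d ∘ sym , b≢d ∘ sym
  flat-unique⇒Disjoint (p ∷ ps) (_ ∷ _ ∷ u) {suc i} {suc j} i≢j = flat-unique⇒Disjoint ps u (i≢j ∘ cong suc)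

-- Extending the precoloring along a matching of colours.

module _ {n : ℕ} (G : Graph (Fin n)) where

  -- `Distance≤` asks for the exact distance, so adjacency of `u` and `v` decides between 1 and 2.
  common-neighbour⇒Distance≤2 : ∀ {x u v} → u ≢ v → Adj G x u → Adj G x v → Distance≤ G 2 u v
  common-neighbour⇒Distance≤2 {x} {u} {v} u≢v xu xv with adj? G u v
  ... | yes uv = 1 , (cons uv nil , minimal) , s≤s z≤n
    where
    minimal : ∀ j → Walk G u v j → 1 ≤ j
    minimal zero    nil = ⊥-elim (u≢v refl)
    minimal (suc j) _   = s≤s z≤n
  ... | no ¬uv = 2 , (cons (Graph.sym G xu) (cons xv nil) , minimal) , ≤-refl
    where
    minimal : ∀ j → Walk G u v j → 2 ≤ j
    minimal zero          nil           = ⊥-elim (u≢v refl)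
    minimal (suc zero)    (cons uv nil) = ⊥-elim (¬uv uv)
    minimal (suc (suc j)) _             = s≤s (s≤s z≤n)

  common-neighbour⇒∈𝒟 : ∀ {P x u v} → u ∈ P → v ∈ P → u ≢ v → Adj G x u → Adj G x v →
                        (u , v) ∈ₗ 𝒟 G P 2 ⊎ (v , u) ∈ₗ 𝒟 G P 2
  common-neighbour⇒∈𝒟 {P} {x} {u} {v} u∈P v∈P u≢v xu xv with Fin.<-cmp u v
  ... | tri< u<v _ _ = inj₁ (∈-filter⁺ (closePair? G P 2) (∈-cartesianProduct⁺ (∈-allFin u) (∈-allFin v))
                              (u<v , u∈P , v∈P , common-neighbour⇒Distance≤2 u≢v xu xv))
  ... | tri≈ _ u≡v _ = ⊥-elim (u≢v u≡v)
  ... | tri> _ _ v<u = inj₂ (∈-filter⁺ (closePair? G P 2) (∈-cartesianProduct⁺ (∈-allFin v) (∈-allFin u))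
                              (v<u , v∈P , u∈P , common-neighbour⇒Distance≤2 (u≢v ∘ sym) xv xu))

  module Extension {m s t : ℕ} (P : Subset n) (d : ∃ (_∈ P) → Fin m) (d-proper : IsPrecoloring G P d)
    (c : Fin n → Fin t ⊎ Fin s) (c-proper : Proper G c)
    (pair : Fin t → Fin m × Fin m) (disjoint : ∀ {i j} → i ≢ j → Disjoint (pair i) (pair j))
    (safe : ∀ {x u v i} (u∈P : u ∈ P) (v∈P : v ∈ P) → c x ≡ inj₁ i → Adj G x u → Adj G x v →
            d (u , u∈P) ≡ proj₁ (pair i) → d (v , v∈P) ≡ proj₂ (pair i) → ⊥)
    where

    d-irrelevant : ∀ {u} (p q : u ∈ P) → d (u , p) ≡ d (u , q)
    d-irrelevant {u} p q = cong (λ p → d (u , p)) ([]=-irrelevant p q)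

    Near : Fin n → Fin m → Set
    Near x a = ∃ λ u → Σ (u ∈ P) λ u∈P → Adj G x u × d (u , u∈P) ≡ a

    near? : ∀ x a → Dec (Near x a)
    near? x a = any? neighbour?
      where
      neighbour? : ∀ u → Dec (Σ (u ∈ P) λ u∈P → Adj G x u × d (u , u∈P) ≡ a)
      neighbour? u with u ∈? P
      ... | no  u∉P = no λ (u∈P , _) → u∉P u∈P
      ... | yes u∈P = map′ (u∈P ,_) (λ (q , xu , e) → xu , trans (d-irrelevant u∈P q) e) (adj? G x u ×-dec d (u , u∈P) Fin.≟ a)

    pick : ∀ {x} i → Dec (Near x (proj₁ (pair i))) → Fin m
    pick i (yes _) = proj₂ (pair i)
    pick i (no  _) = proj₁ (pair i)

    pick-disjoint : ∀ {x y i j} → i ≢ j → ∀ p q → pick {x} i p ≢ pick {y} j q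
    pick-disjoint i≢j (yes _) (yes _) = proj₂ (proj₂ (proj₂ (disjoint i≢j)))
    pick-disjoint i≢j (yes _) (no  _) = proj₁ (proj₂ (proj₂ (disjoint i≢j)))
    pick-disjoint i≢j (no  _) (yes _) = proj₁ (proj₂ (disjoint i≢j))
    pick-disjoint i≢j (no  _) (no  _) = proj₁ (disjoint i≢j)

    -- The second colour is picked only when `x` already sees the first; seeing the second as well
    -- would contradict `safe`.
    pick-avoids : ∀ {x u i} (u∈P : u ∈ P) → c x ≡ inj₁ i → Adj G x u → ∀ q → d (u , u∈P) ≢ pick {x} i q
    pick-avoids u∈P cx xu (yes (v , v∈P , xv , dv)) du = safe v∈P u∈P cx xv xu dv du
    pick-avoids u∈P cx xu (no ¬near)                du = ¬near (_ , u∈P , xu , du)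

    choose : ∀ x → Dec (x ∈ P) → Fin t ⊎ Fin s → Fin m ⊎ Fin s
    choose x (yes x∈P) _        = inj₁ (d (x , x∈P))
    choose x (no  _)   (inj₁ i) = inj₁ (pick i (near? x (proj₁ (pair i))))
    choose x (no  _)   (inj₂ j) = inj₂ j

    choose-proper : ∀ {u v} → Adj G u v → ∀ p q {cu cv} → c u ≡ cu → c v ≡ cv → choose u p cu ≢ choose v q cv
    choose-proper uv (yes p) (yes q) _ _ e = d-proper uv (inj₁-injective e)
    choose-proper uv (yes p) (no _) {cv = inj₁ i} _ cv e = pick-avoids p cv (Graph.sym G uv) (near? _ _) (inj₁-injective e)
    choose-proper uv (yes p) (no _) {cv = inj₂ j} _ _ ()
    choose-proper uv (no _) (yes q) {inj₁ i} cu _ e = pick-avoids q cu uv (near? _ _) (sym (inj₁-injective e))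
    choose-proper uv (no _) (yes q) {inj₂ j} _ _ ()
    -- Adjacent vertices lie in different classes, whose pairs of colours are disjoint.
    choose-proper uv (no _) (no _) {inj₁ i} {inj₁ j} cu cv e =
      pick-disjoint (λ i≡j → c-proper uv (trans cu (trans (cong inj₁ i≡j) (sym cv)))) (near? _ _) (near? _ _) (inj₁-injective e)
    choose-proper uv (no _) (no _) {inj₁ i} {inj₂ j} _ _ ()
    choose-proper uv (no _) (no _) {inj₂ i} {inj₁ j} _ _ ()
    choose-proper uv (no _) (no _) {inj₂ i} {inj₂ j} cu cv e =
      c-proper uv (trans cu (trans (cong inj₂ (inj₂-injective e)) (sym cv)))

    choose-extends : ∀ {v} (v∈P : v ∈ P) p cv → choose v p cv ≡ inj₁ (d (v , v∈P))
    choose-extends v∈P (yes p)  _ = cong inj₁ (d-irrelevant p v∈P)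
    choose-extends v∈P (no v∉P) _ = ⊥-elim (v∉P v∈P)

    extension : ∃ λ (f : Fin n → Fin (m + s)) → IsColoring G (m + s) f × Extends P f d
    extension = f , proper , extends
      where
      f : Fin n → Fin (m + s)
      f v = join m s (choose v (v ∈? P) (c v))

      proper : IsColoring G (m + s) f
      proper {u} {v} uv e = choose-proper uv (u ∈? P) (v ∈? P) refl refl
        (trans (sym (splitAt-join m s _)) (trans (cong (splitAt m) e) (splitAt-join m s _)))

      extends : Extends P f d
      extends v v∈P = trans (cong (toℕ ∘ join m s) (choose-extends v∈P (v ∈? P) (c v))) (toℕ-↑ˡ (d (v , v∈P)) s)

  module _ {m t s : ℕ} (c : Fin n → Fin (suc t + s)) (c-proper : Proper G c)
    (P : Subset n) (d : ∃ (_∈ P) → Fin m) (d-proper : IsPrecoloring G P d) where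

    -- `EdgeWeight` expects a colour at every vertex; the entries of `𝒟` have both ends in `P`,
    -- where `d` supplies it.
    totalise : Fin m → Fin n → Fin m
    totalise default v with v ∈? P
    ... | yes v∈P = d (v , v∈P)
    ... | no  _   = default

    totalise-∈ : ∀ default {v} (v∈P : v ∈ P) → totalise default v ≡ d (v , v∈P)
    totalise-∈ default {v} v∈P with v ∈? P
    ... | yes p   = cong (λ p → d (v , p)) ([]=-irrelevant p v∈P)
    ... | no  v∉P = ⊥-elim (v∉P v∈P)

    extend-along-matching : ∀ default → let w = EdgeWeight.weight (totalise default) (𝒟 G P 2) in
      ∀ p ps → length ps ≡ t → Unique (flat (p ∷ ps)) → w (proj₁ p) (proj₂ p) ≤ 1 → All (λ z → w (proj₁ z) (proj₂ z) ≡ 0) ps →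
      ∃ λ (f : Fin n → Fin (m + s)) → IsColoring G (m + s) f × Extends P f d
    extend-along-matching default p ps refl unique w≤1 zeros =
      Extension.extension P d d-proper c′ c′-proper (lookup (p ∷ ps)) (flat-unique⇒Disjoint (p ∷ ps) unique) safe
      where
      open EdgeWeight (totalise default)

      -- `proj₁` selects an end of the close pair coloured by `p`; `zero` is the class returned when
      -- `𝒟` is empty.
      α×same = common-value (c ∘ proj₁) zero (𝒟 G P 2) w≤1
      α      = proj₁ α×same

      -- The class of α is renamed to 0, which gets the pair p: a close pair coloured by p has an
      -- end in that class, so no vertex of the class is adjacent to both of its ends.
      c′ : Fin n → Fin (suc t) ⊎ Fin s
      c′ v = splitAt (suc t) (transpose α zero (c v))

      splitAt-injective : ∀ (i j : Fin (suc t + s)) → splitAt (suc t) i ≡ splitAt (suc t) j → i ≡ j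
      splitAt-injective i j e =
        trans (sym (join-splitAt (suc t) s i)) (trans (cong (join (suc t) s) e) (join-splitAt (suc t) s j))

      relabel-injective : ∀ (i j : Fin (suc t + s)) → transpose α zero i ≡ transpose α zero j → i ≡ j
      relabel-injective i j e =
        trans (sym (transpose-inverse zero α)) (trans (cong (transpose zero α) e) (transpose-inverse zero α))

      c′-proper : Proper G c′
      c′-proper {u} {v} uv e = c-proper uv
        (relabel-injective (c u) (c v) (splitAt-injective (transpose α zero (c u)) (transpose α zero (c v)) e))

      class-0 : ∀ {v} → c′ v ≡ inj₁ zero → c v ≡ α
      class-0 {v} e = trans (sym (transpose-inverse zero α))
                            (cong (transpose zero α) (splitAt-injective (transpose α zero (c v)) zero e))

      safe : ∀ {x u v i} (u∈P : u ∈ P) (v∈P : v ∈ P) → c′ x ≡ inj₁ i → Adj G x u → Adj G x v →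
             d (u , u∈P) ≡ proj₁ (lookup (p ∷ ps) i) → d (v , v∈P) ≡ proj₂ (lookup (p ∷ ps) i) → ⊥
      safe {x} {u} {v} {i} u∈P v∈P cx xu xv du dv = blocked i cx gu gv (common-neighbour⇒∈𝒟 u∈P v∈P u≢v xu xv)
        where
        gu : totalise default u ≡ proj₁ (lookup (p ∷ ps) i)
        gu = trans (totalise-∈ default u∈P) du

        gv : totalise default v ≡ proj₂ (lookup (p ∷ ps) i)
        gv = trans (totalise-∈ default v∈P) dv

        u≢v : u ≢ v
        u≢v u≡v = flat-unique⇒≢ (p ∷ ps) unique i (trans (sym gu) (trans (cong (totalise default) u≡v) gv))

        blocked : ∀ i → c′ x ≡ inj₁ i →
                  totalise default u ≡ proj₁ (lookup (p ∷ ps) i) → totalise default v ≡ proj₂ (lookup (p ∷ ps) i) →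
                  ¬ ((u , v) ∈ₗ 𝒟 G P 2 ⊎ (v , u) ∈ₗ 𝒟 G P 2)
        -- The first entry of the close pair has class `α`, as does `x`, yet the two are adjacent.
        blocked zero cx gu gv (inj₁ uv∈) = c-proper xu (trans (class-0 cx) (sym (proj₂ α×same uv∈ (inj₁ (gu , gv)))))
        blocked zero cx gu gv (inj₂ vu∈) = c-proper xv (trans (class-0 cx) (sym (proj₂ α×same vu∈ (inj₂ (gv , gu)))))
        -- All other pairs have weight 0, whereas this close pair would give weight at least 1.
        blocked (suc i) cx gu gv uv∈ = contradiction (subst (1 ≤_) (All.lookup zeros (∈-lookup i)) (pos uv∈)) λ ()
          where
          pos : (u , v) ∈ₗ 𝒟 G P 2 ⊎ (v , u) ∈ₗ 𝒟 G P 2 → 1 ≤ weight (𝒟 G P 2) (proj₁ (lookup ps i)) (proj₂ (lookup ps i))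
          pos (inj₁ uv∈) = weight-pos uv∈ (inj₁ (gu , gv))
          pos (inj₂ vu∈) = weight-pos vu∈ (inj₂ (gv , gu))

    -- The two inequalities refute the two alternatives of `ManyEdges`, so a nearly zero matching of
    -- all `m` colours exists; it has `t + 1` pairs, one for each class in `Fin (suc t)`.
    extend : m ≡ 3 + t * 2 → 3 + ∣𝒟∣ G P 2 < 3 * m → 8 * ∣𝒟∣ G P 2 < (m + 3) * (m + 5) →
             ∃ λ (f : Fin n → Fin (m + s)) → IsColoring G (m + s) f × Extends P f d
    extend m≡ few few′ = [ use , ⊥-elim ∘ too-many ]′ (nearlyZeroMatching t (allFin m) (trans length-allFin m≡))
      where
      default : Fin m
      default = subst Fin (sym m≡) zero

      open EdgeWeight (totalise default)
      open Weighted (weight (𝒟 G P 2)) (weight-sym (𝒟 G P 2))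
      open Totals (weight (𝒟 G P 2))

      length-allFin : length (allFin m) ≡ m
      length-allFin = length-tabulate _

      total≤ : total (allFin m) ≤ ∣𝒟∣ G P 2
      total≤ = total-weight (𝒟 G P 2) (allFin⁺ m)

      too-many : ¬ ManyEdges (allFin m)
      too-many e rewrite length-allFin with e
      ... | inj₁ h = <⇒≱ few  (≤-trans h (+-monoʳ-≤ 3 total≤))
      ... | inj₂ h = <⇒≱ few′ (≤-trans h (*-monoʳ-≤ 8 total≤))

      use : NearlyZeroMatching (allFin m) → _
      use (y , p , ps , l↭ , w≤1 , zeros)
        with Permutation.Unique-resp-↭ (setoid (Fin m)) (↭⇒↭ₛ (↭-sym l↭)) (allFin⁺ m)
      ... | _ ∷ unique = extend-along-matching default p ps length-ps unique w≤1 zeros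
        where
        -- The uncovered colour `y` and the pair `p` account for the 3 in `m ≡ 3 + t * 2`.
        length-ps : length ps ≡ t
        length-ps = *-cancelˡ-≡ _ _ 2 (+-cancelˡ-≡ 3 _ _
          (trans (cong (3 +_) (sym (length-flat ps))) (trans (↭-length l↭) (trans length-allFin (trans m≡ (cong (3 +_) (*-comm t 2)))))))

-- Choice of the numbers of pairs and of new colours.

theorem15 : ∀ (r k : ℕ) → 1 ≤ r → 1 ≤ k → 2 ≤ r → (r + k) % 2 ≡ 1 → k < r →
    ∀ (n : ℕ) (G : Graph (Fin n)) →
    ∀ (χ : ℕ) → IsChromaticNumber G χ → χ ≤ r →
    ∀ (P : Subset n) (d : ∃ (_∈ P) → Fin (r + k)) → IsPrecoloring G P d →
    ∣𝒟∣ G P 2 < (3 * (r + k ∸ 1)) ⊓ (((r + k + 3) * (r + k + 5)) / 8) →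
    ∃ λ (f : Fin n → Fin ((3 * r + k + 1) / 2)) → IsColoring G ((3 * r + k + 1) / 2) f × Extends P f d
theorem15 r k _ 1≤k 2≤r odd k<r n G χ ((c , c-proper) , _) χ≤r P d d-proper few
  with (r + k) / 2 | trans (m≡m%n+[m/n]*n (r + k) 2) (cong (_+ (r + k) / 2 * 2) odd)
-- Quotient 0 would mean `r + k = 1`; otherwise there are `t + 1` pairs.
... | zero  | r+k≡ = contradiction (≤-trans (+-mono-≤ 2≤r 1≤k) (≤-reflexive r+k≡)) λ { (s≤s ()) }
... | suc t | r+k≡ = subst (λ M → ∃ λ (f : Fin n → Fin M) → IsColoring G M f × Extends P f d) (sym palette)
    (extend G {t = t} {s} c′ c′-proper P d d-proper r+k≡ few₁ few₂)
  where
  N = ∣𝒟∣ G P 2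

  -- By `k < r`, `2 (t + 1)` is at most `r + k`, hence at most `2 r`: there are enough classes for
  -- the pairs.
  t<r : suc t ≤ r
  t<r = *-cancelʳ-≤ (suc t) r 2 (≤-trans (n≤1+n (suc t * 2)) (≤-trans (≤-reflexive (sym r+k≡))
          (≤-trans (+-monoʳ-≤ r (<⇒≤ k<r)) (≤-reflexive (lem r)))))
    where
    lem : ∀ r → r + r ≡ r * 2
    lem = solve-∀

  s = r ∸ suc t

  r≡ : suc t + s ≡ r
  r≡ = m+[n∸m]≡n t<r

  -- Since `2 s = 2 r - (r + k - 1)`, doubling `(r + k) + s` gives `3 r + k + 1`.
  palette : (3 * r + k + 1) / 2 ≡ (r + k) + s
  palette = trans (cong (_/ 2) double) (m*n/n≡m ((r + k) + s) 2)
    where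
    split : ∀ r k → 3 * r + k + 1 ≡ (r + k) + (2 * r + 1)
    split = solve-∀
    regroup : ∀ m t s → m + (2 * (suc t + s) + 1) ≡ (m + s * 2) + (3 + t * 2)
    regroup = solve-∀
    merge : ∀ m s → (m + s * 2) + m ≡ (m + s) * 2
    merge = solve-∀
    double : 3 * r + k + 1 ≡ ((r + k) + s) * 2
    double = trans (split r k) (trans (cong (λ r′ → (r + k) + (2 * r′ + 1)) (sym r≡))
               (trans (regroup (r + k) t s) (trans (cong ((r + k) + s * 2 +_) (sym r+k≡)) (merge (r + k) s))))

  χ≤ : χ ≤ suc t + s
  χ≤ = ≤-trans χ≤r (≤-reflexive (sym r≡))

  c′ : Fin n → Fin (suc t + s)
  c′ v = inject≤ (c v) χ≤

  c′-proper : Proper G c′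
  c′-proper uv e = c-proper uv (inject≤-injective χ≤ χ≤ _ _ e)

  few₁ : 3 + N < 3 * (r + k)
  few₁ = subst (λ m → 3 + N < 3 * m) (sym r+k≡) (≤-trans (+-monoʳ-< 3 (subst (λ m → N < 3 * (m ∸ 1)) r+k≡ (m<n⊓o⇒m<n _ _ few)))
           (≤-reflexive (lem (2 + t * 2))))
    where
    lem : ∀ x → 3 + 3 * x ≡ 3 * suc x
    lem = solve-∀

  -- Multiplying the rounded quotient back by 8 cannot exceed the product. It is in fact exact, as
  -- `r + k` is odd and the factors are consecutive even numbers.
  few₂ : 8 * N < (r + k + 3) * (r + k + 5)
  few₂ = begin-strict
    8 * N                                      <⟨ *-monoʳ-< 8 (m<n⊓o⇒m<o (3 * (r + k ∸ 1)) _ few) ⟩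
    8 * ((r + k + 3) * (r + k + 5) / 8)        ≡⟨ *-comm 8 ((r + k + 3) * (r + k + 5) / 8) ⟩
    (r + k + 3) * (r + k + 5) / 8 * 8          ≤⟨ m/n*n≤m _ 8 ⟩
    (r + k + 3) * (r + k + 5)                  ∎
    where open ≤-Reasoning
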